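{- Let $m \geq 1$ and $n \geq 1$ be integers. The map $$g: \mathbb{U}_m \wr \mathfrak{S}_n \rightarrow \langle\mathsf{G}, \mathsf{g}\rangle_{n-1}, \qquad \pi \mapsto \sum_{i=1}^{n} \mathtt{pinv}_i(\pi)\, \mathsf{G}_{n-i},$$ is bijective.
   Context: $\mathfrak{S}_n$ is the symmetric group on $[n]=\{1,\dots,n\}$, $\mathbb{U}_m$ is the group of $m$-th roots of unity, and $\mathbb{U}_m \wr \mathfrak{S}_n$ is their wreath product (the colored permutation group of $m$ colors and $n$ elements). An element $\pi \in \mathbb{U}_m \wr \mathfrak{S}_n$ is represented as $\pi = \begin{pmatrix} 1 & 2 & \dots & n\\ \zeta_{k_1}\sigma(1) & \zeta_{k_2}\sigma(2) & \dots & \zeta_{k_n}\sigma(n)\end{pmatrix}$ with $\sigma \in \mathfrak{S}_n$, $\zeta_{k_j} = e^{2\pi \sqrt{ -1}\, k_j/m}$ and $k_j \in \{0,1,\dots,m-1\}$; thus $\pi$ amounts to a pair consisting of $\sigma\in\mathfrak{S}_n$ and $(k_1,\dots,k_n)\in\{0,\dots,m-1\}^n$. For $i \in [n]$, the number of $i$-pseudoinversions of $\pi$ is $$\mathtt{pinv}_i\,\pi := k_i(n-i+1) + \big|\{j \in \{i+1,\dots,n\} \mid \sigma(i) > \sigma(j)\}\big|.$$ For $i \in \mathbb{N}=\{0,1,2,\dots\}$ put $\mathsf{G}_i = m^i\, i!$ and $\mathsf{g}_i = m(i+1)-1$. For $k \in \mathbb{N}$, put $$\langle\mathsf{G}, \mathsf{g}\rangle_k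 := \Big\{\sum_{i=0}^k \gamma_i \mathsf{G}_i \ \Big|\ \gamma_i \in \{0,1,\dots,\mathsf{g}_i\} \text{ for } 0\le i\le k\Big\}.$$ -}

module Defs where

open import Data.Fin using (Fin; toℕ; _<?_)
open import Data.Fin.Permutation as Perm using (Permutation′; _⟨$⟩ʳ_)
open import Data.List using (allFin; filter; length)
open import Data.Nat using (ℕ; suc; _+_; _∸_; _*_; _^_; _≤_; _!)
open import Data.Nat.Properties using (+-0-commutativeMonoid)
open import Data.Product using (∃; Σ-syntax; _×_; proj₁)
open import Function using (_on_)
open import Level using (0ℓ)
open import Relation.Binary using (Rel)
open import Relation.Binary.PropositionalEquality using (_≡_; _≗_)
open import Relation.Nullary.Decidable using (_×-dec_)
open import Relation.Unary using (Pred; _∈_)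

open import Algebra.Properties.CommutativeMonoid.Sum +-0-commutativeMonoid using (sum)

-- The m-th root of unity ζ_c = e^{2π√-1 c/m} is represented by its exponent
-- c ∈ {0,…,m-1}, and the element j ∈ {1,…,n} by the j' : Fin n with
-- toℕ j' = j - 1.  Thus an element of 𝕌_m ≀ 𝔖_n is a permutation σ together
-- with the exponents k of the roots of unity multiplying σ(1),…,σ(n).
record 𝕌_≀𝔖_ (m n : ℕ) : Set where
  field
    σ : Permutation′ n
    k : Fin n → Fin m

open 𝕌_≀𝔖_ public

-- Equality of colored permutations is pointwise, since propositional equality
-- of the underlying functions is too fine without function extensionality.
infix 4 _≈_

_≈_ : ∀ {m n} → Rel (𝕌 m ≀𝔖 n) 0ℓ
π ≈ ρ = (σ π Perm.≈ σ ρ) × (k π ≗ k ρ)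

-- With i = toℕ i' + 1, the factor n - i + 1 is n ∸ toℕ i'.
pinv : ∀ {m n} → Fin n → 𝕌 m ≀𝔖 n → ℕ
pinv {n = n} i π =
  toℕ (k π i) * (n ∸ toℕ i)
  + length (filter (λ j → (i <? j) ×-dec (σ π ⟨$⟩ʳ j <? σ π ⟨$⟩ʳ i)) (allFin n))

𝖦 : ℕ → ℕ → ℕ
𝖦 m i = m ^ i * i !

-- The truncated subtraction is exact whenever m ≥ 1.
𝗀 : ℕ → ℕ → ℕ
𝗀 m i = m * (i + 1) ∸ 1

⟨𝖦,𝗀⟩ : (m k : ℕ) → Pred ℕ 0ℓ
⟨𝖦,𝗀⟩ m k N =
  Σ[ γ ∈ (Fin (suc k) → ℕ) ]
    (∀ i → γ i ≤ 𝗀 m (toℕ i)) × N ≡ sum (λ i → γ i * 𝖦 m (toℕ i))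

-- ⟨𝖦,𝗀⟩ as a type in its own right: its elements are numbers, so two of them
-- are equal when the numbers are, whatever the digits γ witnessing membership.
Elements : Pred ℕ 0ℓ → Set
Elements S = ∃ λ N → N ∈ S

infix 4 _≈ₑ_

_≈ₑ_ : ∀ {S : Pred ℕ 0ℓ} → Rel (Elements S) 0ℓ
_≈ₑ_ = _≡_ on proj₁

-- With i = toℕ i' + 1, the index n - i is n ∸ suc (toℕ i').
g : ∀ {m n} → 𝕌 m ≀𝔖 n → ℕ
g {m} {n} π = sum (λ (i : Fin n) → pinv i π * 𝖦 m (n ∸ suc (toℕ i)))

{-# OPTIONS --safe #-}

-- Deleting the first letter of π (and standardising the remaining ones) leaves
-- the pseudoinversion numbers at the later positions unchanged, while the first
-- one is k₁ n + (σ(1) - 1), an arbitrary number below m n that determines k₁ and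
-- σ(1).  Hence g is a mixed radix expansion with radices m n, m (n - 1), …, m,
-- and by induction on n it is a bijection onto {0, …, mⁿ n! - 1}.

module Submission where

open import Defs
open import Data.Bool using (if_then_else_)
open import Data.Fin
  using (Fin; zero; suc; toℕ; fromℕ<; combine; opposite; punchIn; _<?_)
  renaming (_<_ to _<ᶠ_)
open import Data.Fin.Permutation as Perm
  using (Permutation′; _⟨$⟩ʳ_; insert; remove; remove-insert; punchIn-permute)
open import Data.Fin.Properties
  using (toℕ-injective; toℕ<n; toℕ-fromℕ<; toℕ-combine; combine-injective; combine-surjective;
         opposite-prop; opposite-involutive; punchIn-injective; punchIn-mono-≤; punchIn-cancel-≤)
open import Data.List using (tabulate; filter; length)
open import Data.Nat
  using (ℕ; zero; suc; _≤_; _<_; _∸_; _+_; _*_; _^_; _!; NonZero; >-nonZero; s≤s; z≤n; s<s⁻¹)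
open import Data.Nat.Properties
  using (+-0-commutativeMonoid; *-comm; +-comm; ≤-reflexive; ≤-trans; ≰⇒>; <⇒≱; <-irrefl;
         suc-pred; m*n≢0; +-monoʳ-<; *-monoˡ-≤; ∸-monoˡ-≤; module ≤-Reasoning)
open import Data.Nat.Solver using (module +-*-Solver)
open import Data.Product using (Σ-syntax; _×_; ∃; _,_; proj₂)
import Data.Vec.Functional as Vector
open import Function using (_∘_; id; _⇔_; mk⇔)
open import Function.Structures using (IsBijection)
open import Relation.Binary.PropositionalEquality
open import Relation.Nullary using (Dec; does; yes; no; contradiction)
open import Relation.Nullary.Decidable using (_×-dec_; does-⇔)
open import Relation.Unary using (Pred; Decidable; _∈_)
open import Algebra.Properties.CommutativeMonoid.Sum +-0-commutativeMonoid
  using (sum; sum-cong-≗; sum-permute; sum-replicate-zero)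

-- Counting by sums of indicators

χ : ∀ {a} {A : Set a} → Dec A → ℕ
χ a? = if does a? then 1 else 0

χ-cong : ∀ {a b} {A : Set a} {B : Set b} (a? : Dec A) (b? : Dec B) → A ⇔ B → χ a? ≡ χ b?
χ-cong a? b? A⇔B = cong (if_then 1 else 0) (does-⇔ A⇔B a? b?)

-- Turns the count in `pinv` into a sum, which can be reindexed along a permutation.
length-filter-tabulate : ∀ {a p} {A : Set a} {P : Pred A p} (P? : Decidable P) {n} (f : Fin n → A) →
  length (filter P? (tabulate f)) ≡ sum (λ i → χ (P? (f i)))
length-filter-tabulate P? {zero}  f = refl
length-filter-tabulate P? {suc n} f with P? (f zero)
... | yes _ = cong suc (length-filter-tabulate P? (f ∘ suc))
... | no  _ = length-filter-tabulate P? (f ∘ suc)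

sum-χ-<? : ∀ {n} (i : Fin n) → sum (λ (j : Fin n) → χ (j <? i)) ≡ toℕ i
sum-χ-<? {suc n} zero    = sum-replicate-zero n
sum-χ-<? {suc n} (suc i) = cong suc (sum-χ-<? i)

punchIn-mono-< : ∀ {n} (i : Fin (suc n)) {j k} → j <ᶠ k → punchIn i j <ᶠ punchIn i k
punchIn-mono-< i j<k = ≰⇒> (<⇒≱ j<k ∘ punchIn-cancel-≤ i _ _)

punchIn-cancel-< : ∀ {n} (i : Fin (suc n)) {j k} → punchIn i j <ᶠ punchIn i k → j <ᶠ k
punchIn-cancel-< i j<k = ≰⇒> (<⇒≱ j<k ∘ punchIn-mono-≤ i _ _)

-- Lehmer codes

inversion? : ∀ {n} (π : Permutation′ n) (i j : Fin n) → Dec (i <ᶠ j × π ⟨$⟩ʳ j <ᶠ π ⟨$⟩ʳ i)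
inversion? π i j = (i <? j) ×-dec (π ⟨$⟩ʳ j <? π ⟨$⟩ʳ i)

lehmer : ∀ {n} → Permutation′ n → Fin n → ℕ
lehmer π i = sum (λ j → χ (inversion? π i j))

lehmer-zero : ∀ {n} (π : Permutation′ (suc n)) → lehmer π zero ≡ toℕ (π ⟨$⟩ʳ zero)
lehmer-zero {n} π = begin
  lehmer π zero                             ≡⟨ sum-cong-≗ (λ j → χ-cong (inversion? π zero j) (π ⟨$⟩ʳ j <? π₀) (below j)) ⟩
  sum (λ j → χ (π ⟨$⟩ʳ j <? π₀))           ≡⟨ sum-permute (λ (j : Fin (suc n)) → χ (j <? π₀)) π ⟨
  sum (λ (j : Fin (suc n)) → χ (j <? π₀))   ≡⟨ sum-χ-<? π₀ ⟩
  toℕ π₀                                    ∎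
  where
  π₀ = π ⟨$⟩ʳ zero
  open ≡-Reasoning
  below : ∀ j → (zero {n} <ᶠ j × π ⟨$⟩ʳ j <ᶠ π ⟨$⟩ʳ zero) ⇔ (π ⟨$⟩ʳ j <ᶠ π ⟨$⟩ʳ zero)
  below zero    = mk⇔ proj₂ (λ lt → contradiction lt (<-irrefl refl))
  below (suc j) = mk⇔ proj₂ (s≤s z≤n ,_)

-- The later values of `π` are those of `remove zero π` under `punchIn π₀`, which preserves and
-- reflects the strict order.
lehmer-suc : ∀ {n} (π : Permutation′ (suc n)) i → lehmer π (suc i) ≡ lehmer (remove zero π) i
-- The term at `zero` computes to 0, because `suc i <? zero` decides to false.
lehmer-suc π i = sum-cong-≗ λ j →
  χ-cong (inversion? π (suc i) (suc j)) (inversion? (remove zero π) i j) (inversions j)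
  where
  π₀ = π ⟨$⟩ʳ zero
  π-suc = punchIn-permute π zero
  inversions : ∀ j → (suc i <ᶠ suc j × π ⟨$⟩ʳ suc j <ᶠ π ⟨$⟩ʳ suc i)
                   ⇔ (i <ᶠ j × remove zero π ⟨$⟩ʳ j <ᶠ remove zero π ⟨$⟩ʳ i)
  inversions j = mk⇔
    (λ (i<j , lt) → s<s⁻¹ i<j , punchIn-cancel-< π₀ (subst₂ _<ᶠ_ (π-suc j) (π-suc i) lt))
    (λ (i<j , lt) → s≤s i<j , subst₂ _<ᶠ_ (sym (π-suc j)) (sym (π-suc i)) (punchIn-mono-< π₀ lt))

-- Splitting off the first letter

module _ {m n : ℕ} where

  first : 𝕌 m ≀𝔖 suc n → Fin (m * suc n)
  first π = combine (k π zero) (σ π ⟨$⟩ʳ zero)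

  rest : 𝕌 m ≀𝔖 suc n → 𝕌 m ≀𝔖 n
  rest π = record { σ = remove zero (σ π) ; k = k π ∘ suc }

  cons : Fin m → Fin (suc n) → 𝕌 m ≀𝔖 n → 𝕌 m ≀𝔖 suc n
  cons c j π = record { σ = insert zero j (σ π) ; k = c Vector.∷ k π }

  rest-cong : {π ρ : 𝕌 m ≀𝔖 suc n} → π ≈ ρ → rest π ≈ rest ρ
  rest-cong {π} {ρ} (σ≈ , k≈) = remove≈ , k≈ ∘ suc
    where
    open ≡-Reasoning
    remove≈ : remove zero (σ π) Perm.≈ remove zero (σ ρ)
    -- The two values are compared after the injection `punchIn`, where `punchIn-permute` identifies
    -- them with values of `σ π` and `σ ρ`.
    remove≈ i = punchIn-injective (σ π ⟨$⟩ʳ zero) _ _ (begin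
      punchIn (σ π ⟨$⟩ʳ zero) (remove zero (σ π) ⟨$⟩ʳ i)  ≡⟨ punchIn-permute (σ π) zero i ⟨
      σ π ⟨$⟩ʳ suc i                                       ≡⟨ σ≈ (suc i) ⟩
      σ ρ ⟨$⟩ʳ suc i                                       ≡⟨ punchIn-permute (σ ρ) zero i ⟩
      punchIn (σ ρ ⟨$⟩ʳ zero) (remove zero (σ ρ) ⟨$⟩ʳ i)  ≡⟨ cong (λ j → punchIn j (remove zero (σ ρ) ⟨$⟩ʳ i)) (σ≈ zero) ⟨
      punchIn (σ π ⟨$⟩ʳ zero) (remove zero (σ ρ) ⟨$⟩ʳ i)  ∎)

  rest-cons : ∀ c j π → rest (cons c j π) ≈ π
  rest-cons c j π = remove-insert zero j (σ π) , λ _ → refl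

  first-rest-injective : {π ρ : 𝕌 m ≀𝔖 suc n} → first π ≡ first ρ → rest π ≈ rest ρ → π ≈ ρ
  first-rest-injective {π} {ρ} first≡ (remove≈ , k≈)
    with k₀≡ , σ₀≡ ← combine-injective (k π zero) _ (k ρ zero) _ first≡ = σ≈ , k≈′
    where
    σ≈ : σ π Perm.≈ σ ρ
    σ≈ zero    = σ₀≡
    σ≈ (suc i) = begin
      σ π ⟨$⟩ʳ suc i                                       ≡⟨ punchIn-permute (σ π) zero i ⟩
      punchIn (σ π ⟨$⟩ʳ zero) (remove zero (σ π) ⟨$⟩ʳ i)  ≡⟨ cong₂ punchIn σ₀≡ (remove≈ i) ⟩
      punchIn (σ ρ ⟨$⟩ʳ zero) (remove zero (σ ρ) ⟨$⟩ʳ i)  ≡⟨ punchIn-permute (σ ρ) zero i ⟨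
      σ ρ ⟨$⟩ʳ suc i                                       ∎
      where open ≡-Reasoning
    k≈′ : k π ≗ k ρ
    k≈′ zero    = k₀≡
    k≈′ (suc i) = k≈ i

pinv-lehmer : ∀ {m n} i (π : 𝕌 m ≀𝔖 n) → pinv i π ≡ toℕ (k π i) * (n ∸ toℕ i) + lehmer (σ π) i
pinv-lehmer {n = n} i π = cong (toℕ (k π i) * (n ∸ toℕ i) +_) (length-filter-tabulate (inversion? (σ π) i) id)

pinv-zero : ∀ {m n} (π : 𝕌 m ≀𝔖 suc n) → pinv zero π ≡ toℕ (first π)
pinv-zero {n = n} π = begin
  pinv zero π                                         ≡⟨ pinv-lehmer zero π ⟩
  toℕ (k π zero) * suc n + lehmer (σ π) zero          ≡⟨ cong₂ _+_ (*-comm (toℕ (k π zero)) (suc n)) (lehmer-zero (σ π)) ⟩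
  suc n * toℕ (k π zero) + toℕ (σ π ⟨$⟩ʳ zero)       ≡⟨ toℕ-combine (k π zero) (σ π ⟨$⟩ʳ zero) ⟨
  toℕ (first π)                                       ∎
  where open ≡-Reasoning

pinv-suc : ∀ {m n} i (π : 𝕌 m ≀𝔖 suc n) → pinv (suc i) π ≡ pinv i (rest π)
pinv-suc {n = n} i π = begin
  pinv (suc i) π                                                     ≡⟨ pinv-lehmer (suc i) π ⟩
  toℕ (k π (suc i)) * (n ∸ toℕ i) + lehmer (σ π) (suc i)            ≡⟨ cong (toℕ (k π (suc i)) * (n ∸ toℕ i) +_) (lehmer-suc (σ π) i) ⟩
  toℕ (k π (suc i)) * (n ∸ toℕ i) + lehmer (remove zero (σ π)) i    ≡⟨ pinv-lehmer i (rest π) ⟨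
  pinv i (rest π)                                                    ∎
  where open ≡-Reasoning

<⇒≤𝗀 : ∀ m n {x} → x < m * suc n → x ≤ 𝗀 m n
<⇒≤𝗀 m n x< rewrite +-comm n 1 = ∸-monoˡ-≤ 1 x<

≤𝗀⇒< : ∀ m .{{_ : NonZero m}} n {x} → x ≤ 𝗀 m n → x < m * suc n
≤𝗀⇒< m n x≤ rewrite +-comm n 1 =
  -- As `m` is nonzero, `m * suc n` is positive and the truncated `∸ 1` in `𝗀` is exact.
  ≤-trans (s≤s x≤) (≤-reflexive (suc-pred (m * suc n) {{m*n≢0 m (suc n)}}))

-- Deleting the letters before position `i` makes it the first one, where the number is a `toℕ` of
-- an element of the right `Fin`.
pinv≤𝗀 : ∀ {m n} i (π : 𝕌 m ≀𝔖 n) → pinv i π ≤ 𝗀 m (n ∸ suc (toℕ i))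
pinv≤𝗀 {m} {suc n} zero    π rewrite pinv-zero π  = <⇒≤𝗀 m n (toℕ<n (first π))
pinv≤𝗀 {m} {suc n} (suc i) π rewrite pinv-suc i π = pinv≤𝗀 i (rest π)

-- The mixed radix expansion

-- This is mⁿ n!, written recursively so that `combine` has the type needed by `rank`.
radixProduct : ℕ → ℕ → ℕ
radixProduct m zero    = 1
radixProduct m (suc n) = (m * suc n) * radixProduct m n

𝖦≡radixProduct : ∀ m n → 𝖦 m n ≡ radixProduct m n
𝖦≡radixProduct m zero    = refl
𝖦≡radixProduct m (suc n) = begin
  (m * m ^ n) * (suc n * n !)     ≡⟨ solve 4 (λ a b c d → (a :* b) :* (c :* d) := (a :* c) :* (b :* d)) refl m (m ^ n) (suc n) (n !) ⟩
  (m * suc n) * 𝖦 m n             ≡⟨ cong ((m * suc n) *_) (𝖦≡radixProduct m n) ⟩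
  radixProduct m (suc n)          ∎
  where open ≡-Reasoning; open +-*-Solver

-- The value of `g` with its bound built into the type; bijectivity is inherited from `combine`, one
-- digit at a time.
rank : ∀ {m n} → 𝕌 m ≀𝔖 n → Fin (radixProduct m n)
rank {n = zero}  π = zero
rank {n = suc n} π = combine (first π) (rank (rest π))

g≡rank : ∀ {m n} (π : 𝕌 m ≀𝔖 n) → g π ≡ toℕ (rank π)
g≡rank {n = zero}      π = refl
g≡rank {m} {n = suc n} π = begin
  pinv zero π * 𝖦 m n + sum (λ i → pinv (suc i) π * 𝖦 m (n ∸ suc (toℕ i)))
    ≡⟨ cong₂ _+_ (cong₂ _*_ (pinv-zero π) (𝖦≡radixProduct m n))
                 (sum-cong-≗ (λ i → cong (_* 𝖦 m (n ∸ suc (toℕ i))) (pinv-suc i π))) ⟩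
  toℕ (first π) * radixProduct m n + g (rest π)
    ≡⟨ cong₂ _+_ (*-comm (toℕ (first π)) _) (g≡rank (rest π)) ⟩
  radixProduct m n * toℕ (first π) + toℕ (rank (rest π))
    ≡⟨ toℕ-combine (first π) (rank (rest π)) ⟨
  toℕ (rank π)
    ∎
  where open ≡-Reasoning

rank-cong : ∀ {m n} {π ρ : 𝕌 m ≀𝔖 n} → π ≈ ρ → rank π ≡ rank ρ
rank-cong {n = zero}  π≈ρ = refl
rank-cong {n = suc n} {π} {ρ} π≈ρ@(σ≈ , k≈) =
  cong₂ combine (cong₂ combine (k≈ zero) (σ≈ zero)) (rank-cong (rest-cong {π = π} {ρ} π≈ρ))

rank-injective : ∀ {m n} {π ρ : 𝕌 m ≀𝔖 n} → rank π ≡ rank ρ → π ≈ ρ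
rank-injective {n = zero}  eq = (λ ()) , (λ ())
rank-injective {n = suc n} {π} {ρ} eq
  with first≡ , rest≡ ← combine-injective (first π) _ (first ρ) _ eq =
  first-rest-injective {π = π} {ρ} first≡ (rank-injective {π = rest π} {rest ρ} rest≡)

rank-surjective : ∀ {m n} (r : Fin (radixProduct m n)) → ∃ λ (π : 𝕌 m ≀𝔖 n) → rank π ≡ r
rank-surjective {n = zero}      zero = record { σ = Perm.id ; k = λ () } , refl
rank-surjective {m} {n = suc n} r
  with d , r′ , refl ← combine-surjective {m * suc n} {radixProduct m n} r
  with c , j , refl ← combine-surjective {m} {suc n} d
  with π , refl ← rank-surjective {m} {n} r′
  -- `first (cons c j π)` computes to `combine c j`, but `rest (cons c j π)` is only `≈ π`, hence
  -- `rank-cong`.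
  = cons c j π , cong (combine (combine c j)) (rank-cong (rest-cons c j π))

-- Comparison with the target set

opposite-∸ : ∀ {n} (i : Fin n) → n ∸ suc (toℕ (opposite i)) ≡ toℕ i
opposite-∸ i = trans (sym (opposite-prop (opposite i))) (cong toℕ (opposite-involutive i))

-- Mediates between the ascending weights of `⟨𝖦,𝗀⟩` and the descending ones of `g`.
sum-reverse : ∀ m n (γ : Fin n → ℕ) →
  sum (λ i → γ i * 𝖦 m (toℕ i)) ≡ sum (λ i → γ (opposite i) * 𝖦 m (n ∸ suc (toℕ i)))
sum-reverse m n γ = trans (sum-permute (λ i → γ i * 𝖦 m (toℕ i)) Perm.reverse)
  (sum-cong-≗ (λ i → cong (λ e → γ (opposite i) * 𝖦 m e) (opposite-prop i)))

-- By induction the lower digits contribute less than one unit of the leading weight, so the sum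
-- stays below `suc (δ zero)` units.
descending-sum-< : ∀ m .{{_ : NonZero m}} n (δ : Fin n → ℕ) → (∀ i → δ i ≤ 𝗀 m (n ∸ suc (toℕ i))) →
  sum (λ i → δ i * 𝖦 m (n ∸ suc (toℕ i))) < radixProduct m n
descending-sum-< m zero    δ δ≤ = s≤s z≤n
descending-sum-< m (suc n) δ δ≤ = begin-strict
  δ zero * 𝖦 m n + lower                          ≡⟨ cong (λ b → δ zero * b + lower) (𝖦≡radixProduct m n) ⟩
  δ zero * radixProduct m n + lower               <⟨ +-monoʳ-< _ (descending-sum-< m n (δ ∘ suc) (δ≤ ∘ suc)) ⟩
  δ zero * radixProduct m n + radixProduct m n    ≡⟨ +-comm _ (radixProduct m n) ⟩
  suc (δ zero) * radixProduct m n                 ≤⟨ *-monoˡ-≤ (radixProduct m n) (≤𝗀⇒< m n (δ≤ zero)) ⟩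
  radixProduct m (suc n)                          ∎
  where
  open ≤-Reasoning
  lower = sum (λ i → δ (suc i) * 𝖦 m (n ∸ suc (toℕ i)))

⟨𝖦,𝗀⟩⇒< : ∀ m .{{_ : NonZero m}} n {N} → N ∈ ⟨𝖦,𝗀⟩ m n → N < radixProduct m (suc n)
⟨𝖦,𝗀⟩⇒< m n (γ , γ≤ , refl) rewrite sum-reverse m (suc n) γ =
  descending-sum-< m (suc n) (γ ∘ opposite)
    (λ i → subst (λ e → γ (opposite i) ≤ 𝗀 m e) (opposite-prop i) (γ≤ (opposite i)))

g∈⟨𝖦,𝗀⟩ : ∀ {m n} (π : 𝕌 m ≀𝔖 suc n) → g π ∈ ⟨𝖦,𝗀⟩ m n
g∈⟨𝖦,𝗀⟩ {m} {n} π = γ , γ≤ , sym (trans (sum-reverse m (suc n) γ)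
  (sum-cong-≗ (λ i → cong (λ j → pinv j π * 𝖦 m (n ∸ toℕ i)) (opposite-involutive i))))
  where
  γ : Fin (suc n) → ℕ
  -- The digit of weight `𝖦 m (toℕ i)` sits at the mirrored position.
  γ i = pinv (opposite i) π
  γ≤ : ∀ i → γ i ≤ 𝗀 m (toℕ i)
  γ≤ i = subst (λ e → γ i ≤ 𝗀 m e) (opposite-∸ i) (pinv≤𝗀 (opposite i) π)

≈-refl : ∀ {m n} {π : 𝕌 m ≀𝔖 n} → π ≈ π
≈-refl = (λ _ → refl) , (λ _ → refl)

theorem1p6 : (m n : ℕ) → 1 ≤ m → 1 ≤ n →
    Σ[ g∈ ∈ ((π : 𝕌 m ≀𝔖 n) → g π ∈ ⟨𝖦,𝗀⟩ m (n ∸ 1)) ]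
    IsBijection (_≈_ {m} {n}) (_≈ₑ_ {⟨𝖦,𝗀⟩ m (n ∸ 1)}) (λ π → g π , g∈ π)
theorem1p6 m (suc n) 1≤m _ = g∈⟨𝖦,𝗀⟩ , record
  { isInjection = record
    { isCongruent = record
      { cong           = λ {π} {ρ} → g-cong {π} {ρ}
      ; isEquivalence₁ = record
        { refl  = λ {π} → ≈-refl {π = π}
        ; sym   = λ (σ≈ , k≈) → (sym ∘ σ≈) , (sym ∘ k≈)
        ; trans = λ (σ≈ , k≈) (σ≈′ , k≈′) →
            (λ i → trans (σ≈ i) (σ≈′ i)) , (λ i → trans (k≈ i) (k≈′ i))
        }
      ; isEquivalence₂ = record { refl = refl ; sym = sym ; trans = trans }
      }
    ; injective = λ {π} {ρ} eq →
        rank-injective {π = π} {ρ} (toℕ-injective (trans (sym (g≡rank π)) (trans eq (g≡rank ρ))))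
    }
  ; surjective = surjective
  }
  where
  instance
    m≢0 : NonZero m
    m≢0 = >-nonZero 1≤m

  g-cong : {π ρ : 𝕌 m ≀𝔖 suc n} → π ≈ ρ → g π ≡ g ρ
  g-cong {π} {ρ} π≈ρ =
    trans (g≡rank π) (trans (cong toℕ (rank-cong {π = π} {ρ} π≈ρ)) (sym (g≡rank ρ)))

  surjective : ((N , _) : Elements (⟨𝖦,𝗀⟩ m n)) →
    ∃ λ (π : 𝕌 m ≀𝔖 suc n) → ∀ {ρ} → ρ ≈ π → g ρ ≡ N
  -- Membership serves through the bound on `N`, which makes `N` an element of the codomain of
  -- `rank`.
  surjective (N , N∈) with π , eq ← rank-surjective {m} {suc n} (fromℕ< (⟨𝖦,𝗀⟩⇒< m n N∈)) =
    π , λ {ρ} ρ≈π → trans (g-cong {ρ} {π} ρ≈π)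
      (trans (g≡rank π) (trans (cong toℕ eq) (toℕ-fromℕ< (⟨𝖦,𝗀⟩⇒< m n N∈))))
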